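{- Let $\omega$ be chosen uniformly at random from the set $\Omega_n$ of all equi-$n$-squares. Then, as $n\to\infty$, the probability that $\omega$ is a consecutive equi-$n$-square satisfies $$P(\omega\in\Sigma_n)\sim\frac{4n^{n+1}\,(n^2-n)!}{(n^2)!},$$ i.e. the ratio of the two sides tends to $1$.
   Context: An equi-$n$-square is an $n\times n$ array with entries in $\{1,\dots,n\}$ in which each symbol $1,\dots,n$ occurs exactly $n$ times in the whole array; $\Omega_n$ is the set of all equi-$n$-squares. A row (read left to right) or column (read top to bottom) is called consecutive if it equals $(1,2,\dots,n)$ or $(n,n-1,\dots,1)$. An equi-$n$-square is called consecutive if at least one of its rows or columns is consecutive; $\Sigma_n\subseteq\Omega_n$ is the set of all consecutive equi-$n$-squares. -}

module Defs where

open import Data.Fin.Base using (Fin; zero; suc)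
open import Data.Fin.Properties using (_≟_; all?; any?; suc-injective)
open import Data.Integer.Base using (+_)
open import Data.List.Base as List using (List; length; filter; cartesianProductWith)
open import Data.List.Membership.Propositional using (_∈_)
open import Data.List.Membership.Propositional.Properties
  using (∈-cartesianProductWith⁺; ∈-filter⁺; ∈-filter⁻; ∈-allFin)
open import Data.List.Relation.Unary.Any using (here; there)
import Data.List.Relation.Unary.All as All
import Data.List.Relation.Unary.AllPairs as AllPairs
open import Data.List.Relation.Unary.Unique.Propositional using (Unique)
import Data.List.Relation.Unary.Unique.Propositional.Properties as Uniqueₚ
open import Data.Nat.Base as ℕ using (ℕ; zero; suc)
import Data.Nat.Properties as ℕₚ
open import Data.Product.Base using (Σ; ∃; _,_; proj₂)
open import Data.Rational.Base as ℚ using (ℚ; 0ℚ; 1ℚ; _/_; _÷_; _-_; ∣_∣)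
open import Data.Sum.Base using (_⊎_)
open import Data.Vec.Base
  using (Vec; []; _∷_; _++_; lookup; allFin; tabulate; reverse; transpose; concat; replicate; count)
open import Data.Vec.Properties using (≡-dec; ∷-injective)
open import Function.Base using (_∘_; id)
open import Function.Bundles using (_⇔_; mk⇔; module Equivalence)
open import Level using (Level)
open import Relation.Binary.PropositionalEquality
  using (_≡_; _≢_; refl; trans; cong)
open import Relation.Nullary using (yes; no; contradiction)
open import Relation.Nullary.Decidable using (_⊎-dec_)
open import Relation.Unary using (Pred; Decidable)

private
  variable
    a p : Level
    A : Set a
    m n : ℕ

-- The symbols 1, …, n are represented by the elements 0, …, n-1 of Fin n.
-- A square is the vector of its rows.

Square : ℕ → Set
Square n = Vec (Vec (Fin n) n) n

occurrences : Fin n → Square n → ℕ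
occurrences s sq = count (s ≟_) (concat sq)

IsEqui : Pred (Square n) _
IsEqui {n} sq = ∀ s → occurrences s sq ≡ n

isEqui? : Decidable (IsEqui {n})
isEqui? {n} sq = all? (λ s → occurrences s sq ℕₚ.≟ n)

ConsecutiveLine : Pred (Vec (Fin n) n) _
ConsecutiveLine {n} v = v ≡ allFin n ⊎ v ≡ reverse (allFin n)

consecutiveLine? : Decidable (ConsecutiveLine {n})
consecutiveLine? {n} v =
  ≡-dec _≟_ v (allFin n) ⊎-dec ≡-dec _≟_ v (reverse (allFin n))

row column : Square n → Fin n → Vec (Fin n) n
row    sq i = lookup sq i
column sq j = lookup (transpose sq) j

IsConsecutive : Pred (Square n) _
IsConsecutive sq =
  (∃ λ i → ConsecutiveLine (row sq i)) ⊎ (∃ λ j → ConsecutiveLine (column sq j))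

isConsecutive? : Decidable (IsConsecutive {n})
isConsecutive? sq =
  any? (λ i → consecutiveLine? (row sq i)) ⊎-dec
  any? (λ j → consecutiveLine? (column sq j))

allVecs : List A → (n : ℕ) → List (Vec A n)
allVecs xs zero    = List.[ [] ]
allVecs xs (suc n) = cartesianProductWith _∷_ xs (allVecs xs n)

allSquares : (n : ℕ) → List (Square n)
allSquares n = allVecs (allVecs (List.allFin n) n) n

-- The set of equi-n-squares as a list; it is duplicate-free by Ω-unique, so its
-- length is the number of equi-n-squares.
Ω : (n : ℕ) → List (Square n)
Ω n = filter isEqui? (allSquares n)

allVecs-complete : {xs : List A} → (∀ x → x ∈ xs) → (v : Vec A n) → v ∈ allVecs xs n
allVecs-complete all∈ []      = here refl
allVecs-complete all∈ (x ∷ v) =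
  ∈-cartesianProductWith⁺ _∷_ (all∈ x) (allVecs-complete all∈ v)

allVecs-unique : {xs : List A} → Unique xs → ∀ n → Unique (allVecs xs n)
allVecs-unique xs! zero    = All.[] AllPairs.∷ AllPairs.[]
allVecs-unique xs! (suc n) =
  Uniqueₚ.cartesianProductWith⁺ _∷_ ∷-injective xs! (allVecs-unique xs! n)

∈-Ω⇔IsEqui : (sq : Square n) → sq ∈ Ω n ⇔ IsEqui sq
∈-Ω⇔IsEqui {n} sq = mk⇔
  (λ sq∈Ω → proj₂ (∈-filter⁻ isEqui? {xs = allSquares n} sq∈Ω))
  (∈-filter⁺ isEqui? (allVecs-complete (allVecs-complete ∈-allFin) sq))

Ω-unique : ∀ n → Unique (Ω n)
Ω-unique n =
  Uniqueₚ.filter⁺ isEqui? (allVecs-unique (allVecs-unique (Uniqueₚ.allFin⁺ n) n) n)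

private
  count-++ : {P : Pred A p} (P? : Decidable P) (xs : Vec A m) (ys : Vec A n) →
             count P? (xs ++ ys) ≡ count P? xs ℕ.+ count P? ys
  count-++ P? []       ys = refl
  count-++ P? (x ∷ xs) ys with P? x
  ... | yes _ = cong suc (count-++ P? xs ys)
  ... | no  _ = count-++ P? xs ys

  count-concat-replicate : {P : Pred A p} (P? : Decidable P) (xs : Vec A m) → ∀ n →
                           count P? (concat (replicate n xs)) ≡ n ℕ.* count P? xs
  count-concat-replicate P? xs zero    = refl
  count-concat-replicate P? xs (suc n) =
    trans (count-++ P? xs _) (cong (count P? xs ℕ.+_) (count-concat-replicate P? xs n))

  count-absent : (s : Fin m) (f : Fin n → Fin m) → (∀ i → s ≢ f i) →
                 count (s ≟_) (tabulate f) ≡ 0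
  count-absent {n = zero}  s f s∉f = refl
  count-absent {n = suc n} s f s∉f with s ≟ f zero
  ... | yes s≡f0 = contradiction s≡f0 (s∉f zero)
  ... | no  _    = count-absent s (f ∘ suc) (s∉f ∘ suc)

  count-present : (f : Fin n → Fin m) → (∀ {i j} → f i ≡ f j → i ≡ j) → ∀ i →
                  count (f i ≟_) (tabulate f) ≡ 1
  count-present f inj zero with f zero ≟ f zero
  ... | yes _ = cong suc (count-absent _ (f ∘ suc) λ i eq → contradiction (inj eq) λ ())
  ... | no ¬p = contradiction refl ¬p
  count-present f inj (suc i) with f (suc i) ≟ f zero
  ... | yes eq = contradiction (inj eq) λ ()
  ... | no  _  = count-present (f ∘ suc) (suc-injective ∘ inj) i

  ∈⇒length≢0 : {x : A} {xs : List A} → x ∈ xs → ℕ.NonZero (length xs)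
  ∈⇒length≢0 (here  _) = _
  ∈⇒length≢0 (there _) = _

length-Ω≢0 : ∀ n → ℕ.NonZero (length (Ω n))
length-Ω≢0 n = ∈⇒length≢0 (Equivalence.from (∈-Ω⇔IsEqui sq) equi)
  where
  sq : Square n
  sq = replicate n (allFin n)
  equi : IsEqui sq
  equi s = trans (count-concat-replicate (s ≟_) (allFin n) n)
           (trans (cong (n ℕ.*_) (count-present id id s)) (ℕₚ.*-identityʳ n))

-- The probability of P for an element drawn uniformly at random from xs,
-- where xs has no repetitions (for Ω, see Ω-unique).
uniformProb : {P : Pred A p} (xs : List A) .{{_ : ℕ.NonZero (length xs)}} →
              Decidable P → ℚ
uniformProb xs P? = + length (filter P? xs) / length xs

-- g is eventually nonzero and f / g tends to 1.
infix 4 _∼_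

_∼_ : (f g : ℕ → ℚ) → Set
f ∼ g = ∀ (ε : ℚ) → 0ℚ ℚ.< ε → ∃ λ N → ∀ n → N ℕ.≤ n →
  Σ (ℚ.NonZero (g n)) λ gn≢0 → ∣ (f n ÷ g n) {{gn≢0}} - 1ℚ ∣ ℚ.< ε

{-# OPTIONS --safe #-}
-- Fix a set of cells with prescribed symbols.  Counting pairs (square, free cell carrying s)
-- in two ways, and using that transposing two free cells preserves Ω n, one further
-- prescription "cell x carries s" divides the number of squares by the number of free cells
-- and multiplies it by the number of copies of s still to be placed.  Hence each of the 4n
-- prescribed lines occurs in S squares, where S (n²)! = nⁿ (n² - n)! |Ω n|, and the union bound
-- 4nS is the asserted main term.  Prescribing two further cells of a second line shows that two
-- distinct lines occur together in at most n² S / ((n² - n)(n² - n - 1)) squares, so by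
-- Bonferroni the relative error is at most 4n · n² / ((n² - n)(n² - n - 1)) ≤ 16 / n.

module Submission where

open import Defs
open import Data.Integer.Base using (+_; -[1+_])
open import Data.Nat.Base using (ℕ; _+_; _*_; _∸_; _^_; _!)
open import Data.Nat.Properties using (_!≢0)
open import Data.Rational.Base using (_/_)

open import Data.Bool.Base using (true; false; if_then_else_)
open import Data.Fin.Base using (Fin; zero; suc; combine; opposite; inject₁; fromℕ; punchIn)
import Data.Fin.Properties as Fin
open import Data.Fin.Permutation.Components using ()
  renaming (transpose to swap; transpose-inverse to swap-inverse)
import Data.Integer.Base as ℤ
import Data.Integer.Properties as ℤ
open import Data.List.Base as List using (List; []; _∷_; _++_; length; filter; map)
open import Data.List.Membership.Propositional using (_∈_; _∉_; find; lose)
open import Data.List.Membership.Propositional.Properties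
  using (∈-filter⁺; ∈-filter⁻; ∈-map⁺; ∈-map⁻; ∈-allFin; ∈-∃++; ∈-++⁺ʳ; ∈-cartesianProduct⁺)
import Data.List.Properties as List
open import Data.List.Relation.Binary.Permutation.Propositional as ↭ using (_↭_; ↭-sym; ↭-trans)
open import Data.List.Relation.Binary.Permutation.Propositional.Properties
  using (∈-resp-↭; ↭-length; filter-↭; shift)
import Data.List.Relation.Binary.Permutation.Setoid.Properties as Permutation
open import Data.List.Relation.Unary.All as All using (All; []; _∷_)
import Data.List.Relation.Unary.All.Properties as All
open import Data.List.Relation.Unary.AllPairs using ([]; _∷_)
open import Data.List.Relation.Unary.Any as Any using (Any; here; there)
open import Data.List.Relation.Unary.Unique.Propositional using (Unique)
import Data.List.Relation.Unary.Unique.Propositional.Properties as Unique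
open import Data.Nat.Base using (zero; suc; _≤_; _<_; z≤n; NonZero; >-nonZero⁻¹)
open import Data.Nat.ListAction using (sum)
open import Data.Nat.Properties as ℕ using (≤-refl; ≤-trans; ≤-antisym; ≤-reflexive)
open import Data.Nat.Tactic.RingSolver using (solve-∀)
open import Data.Product.Base using (∃; ∃₂; _×_; _,_; proj₁; proj₂)
import Data.Product.Properties as ×
import Data.Rational.Base as ℚ
import Data.Rational.Properties as ℚ
import Data.Rational.Unnormalised.Base as ℚᵘ
import Data.Rational.Unnormalised.Properties as ℚᵘ
open import Data.Sum.Base using (inj₁; inj₂)
open import Data.Vec.Base as Vec using (Vec; lookup; tabulate)
import Data.Vec.Properties as Vec
open import Function.Base using (_∘_; id)
open import Function.Bundles using (_⇔_; mk⇔; module Equivalence)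
open import Level using (Level)
open import Relation.Binary.PropositionalEquality
open import Relation.Nullary using (Dec; yes; no; does; ¬_; contradiction)
open import Relation.Nullary.Decidable using (_×-dec_; _⊎-dec_)
open import Relation.Unary using (Pred; Decidable)

private
  variable
    a b p q : Level
    A : Set a
    B : Set b
    m n : ℕ

-- Finite sums, counting in lists and duplicate-free lists.

∑ : List A → (A → ℕ) → ℕ
∑ xs f = sum (map f xs)

∑-mono : ∀ (xs : List A) {f g : A → ℕ} → (∀ {x} → x ∈ xs → f x ≤ g x) → ∑ xs f ≤ ∑ xs g
∑-mono []       f≤g = z≤n
∑-mono (x ∷ xs) f≤g = ℕ.+-mono-≤ (f≤g (here refl)) (∑-mono xs (f≤g ∘ there))

∑-cong : ∀ (xs : List A) {f g : A → ℕ} → (∀ {x} → x ∈ xs → f x ≡ g x) → ∑ xs f ≡ ∑ xs g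
∑-cong xs f≡g =
  ≤-antisym (∑-mono xs (≤-reflexive ∘ f≡g)) (∑-mono xs (≤-reflexive ∘ sym ∘ f≡g))

∑-+ : ∀ (xs : List A) (f g : A → ℕ) → ∑ xs (λ x → f x + g x) ≡ ∑ xs f + ∑ xs g
∑-+ []       f g = refl
∑-+ (x ∷ xs) f g rewrite ∑-+ xs f g = interchange (f x) (g x) (∑ xs f) (∑ xs g)
  where
  interchange : ∀ a b c d → (a + b) + (c + d) ≡ (a + c) + (b + d)
  interchange = solve-∀

∑-const : ∀ (xs : List A) c → ∑ xs (λ _ → c) ≡ length xs * c
∑-const []       c = refl
∑-const (x ∷ xs) c = cong₂ _+_ {c} refl (∑-const xs c)

∑-distribˡ : ∀ (xs : List A) c (f : A → ℕ) → ∑ xs (λ x → c * f x) ≡ c * ∑ xs f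
∑-distribˡ []       c f = sym (ℕ.*-zeroʳ c)
∑-distribˡ (x ∷ xs) c f rewrite ∑-distribˡ xs c f = sym (ℕ.*-distribˡ-+ c (f x) _)

∑-comm : ∀ (xs : List A) (ys : List B) (f : A → B → ℕ) →
         ∑ xs (λ x → ∑ ys (f x)) ≡ ∑ ys (λ y → ∑ xs (λ x → f x y))
∑-comm []       ys f = sym (trans (∑-const ys 0) (ℕ.*-zeroʳ (length ys)))
∑-comm (x ∷ xs) ys f rewrite ∑-comm xs ys f = sym (∑-+ ys (f x) _)

𝟙 : {P : Set p} → Dec P → ℕ
𝟙 P? = if does P? then 1 else 0

♯ : {P : Pred A p} → Decidable P → List A → ℕ
♯ P? xs = length (filter P? xs)

♯≡∑ : {P : Pred A p} (P? : Decidable P) (xs : List A) → ♯ P? xs ≡ ∑ xs (𝟙 ∘ P?)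
♯≡∑ P? []       = refl
♯≡∑ P? (x ∷ xs) with does (P? x)
... | true  = cong suc (♯≡∑ P? xs)
... | false = ♯≡∑ P? xs

-- Double counting: both sides sum the indicator of `R` over all pairs, in the two possible orders.
♯-comm : {R : A → B → Set p} (R? : ∀ x y → Dec (R x y)) (xs : List A) (ys : List B) →
         ∑ xs (λ x → ♯ (R? x) ys) ≡ ∑ ys (λ y → ♯ (λ x → R? x y) xs)
♯-comm R? xs ys = begin
  ∑ xs (λ x → ♯ (R? x) ys)             ≡⟨ ∑-cong xs (λ {x} _ → ♯≡∑ (R? x) ys) ⟩
  ∑ xs (λ x → ∑ ys (λ y → 𝟙 (R? x y))) ≡⟨ ∑-comm xs ys (λ x y → 𝟙 (R? x y)) ⟩
  ∑ ys (λ y → ∑ xs (λ x → 𝟙 (R? x y))) ≡⟨ ∑-cong ys (λ {y} _ → ♯≡∑ (λ x → R? x y) xs) ⟨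
  ∑ ys (λ y → ♯ (λ x → R? x y) xs)     ∎
  where open ≡-Reasoning

module _ {P : Pred A p} {Q : Pred A q} (P? : Decidable P) (Q? : Decidable Q) where

  𝟙-mono : ∀ {x} → (P x → Q x) → 𝟙 (P? x) ≤ 𝟙 (Q? x)
  𝟙-mono {x} P⇒Q with P? x | Q? x
  ... | no  _  | _      = z≤n
  ... | yes _  | yes _  = ≤-refl
  ... | yes px | no ¬qx = contradiction (P⇒Q px) ¬qx

  ♯-mono : ∀ xs → (∀ {x} → x ∈ xs → P x → Q x) → ♯ P? xs ≤ ♯ Q? xs
  ♯-mono xs P⇒Q rewrite ♯≡∑ P? xs | ♯≡∑ Q? xs = ∑-mono xs (λ x∈xs → 𝟙-mono (P⇒Q x∈xs))

  ♯-inclusion-exclusion : ∀ xs →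
    ♯ P? xs + ♯ Q? xs ≡ ♯ (λ x → P? x ⊎-dec Q? x) xs + ♯ (λ x → P? x ×-dec Q? x) xs
  ♯-inclusion-exclusion xs = begin
    ♯ P? xs + ♯ Q? xs
      ≡⟨ cong₂ _+_ (♯≡∑ P? xs) (♯≡∑ Q? xs) ⟩
    ∑ xs (𝟙 ∘ P?) + ∑ xs (𝟙 ∘ Q?)
      ≡⟨ ∑-+ xs _ _ ⟨
    ∑ xs (λ x → 𝟙 (P? x) + 𝟙 (Q? x))
      ≡⟨ ∑-cong xs (λ {x} _ → pointwise x) ⟩
    ∑ xs (λ x → 𝟙 (P? x ⊎-dec Q? x) + 𝟙 (P? x ×-dec Q? x))
      ≡⟨ ∑-+ xs _ _ ⟩
    ∑ xs (λ x → 𝟙 (P? x ⊎-dec Q? x)) + ∑ xs (λ x → 𝟙 (P? x ×-dec Q? x))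
      ≡⟨ cong₂ _+_ (♯≡∑ _ xs) (♯≡∑ _ xs) ⟨
    ♯ (λ x → P? x ⊎-dec Q? x) xs + ♯ (λ x → P? x ×-dec Q? x) xs
      ∎
    where
    open ≡-Reasoning
    pointwise : ∀ x → 𝟙 (P? x) + 𝟙 (Q? x) ≡ 𝟙 (P? x ⊎-dec Q? x) + 𝟙 (P? x ×-dec Q? x)
    pointwise x with P? x | Q? x
    ... | yes _ | yes _ = refl
    ... | yes _ | no  _ = refl
    ... | no  _ | yes _ = refl
    ... | no  _ | no  _ = refl

♯-cong : {P : Pred A p} {Q : Pred A q} (P? : Decidable P) (Q? : Decidable Q) → ∀ xs →
         (∀ {x} → x ∈ xs → P x → Q x) → (∀ {x} → x ∈ xs → Q x → P x) → ♯ P? xs ≡ ♯ Q? xs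
♯-cong P? Q? xs P⇒Q Q⇒P = ≤-antisym (♯-mono P? Q? xs P⇒Q) (♯-mono Q? P? xs Q⇒P)

♯-none : {P : Pred A p} (P? : Decidable P) → ∀ xs → (∀ {x} → x ∈ xs → ¬ P x) → ♯ P? xs ≡ 0
♯-none P? xs ¬P = cong length (List.filter-none P? (All.tabulate ¬P))

♯-all : {P : Pred A p} (P? : Decidable P) → ∀ xs → (∀ {x} → x ∈ xs → P x) → ♯ P? xs ≡ length xs
♯-all P? xs P = cong length (List.filter-all P? (All.tabulate P))

♯-map : {P : Pred B p} (P? : Decidable P) (f : A → B) → ∀ xs → ♯ P? (map f xs) ≡ ♯ (P? ∘ f) xs
♯-map P? f []       = refl
♯-map P? f (x ∷ xs) with does (P? (f x))
... | true  = cong suc (♯-map P? f xs)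
... | false = ♯-map P? f xs

♯-++ : {P : Pred A p} (P? : Decidable P) → ∀ xs ys → ♯ P? (xs ++ ys) ≡ ♯ P? xs + ♯ P? ys
♯-++ P? xs ys = trans (cong length (List.filter-++ P? xs ys)) (List.length-++ (filter P? xs))

-- Each element of `xs` in turn is moved to the front of `ys` and split off; as `xs` has no
-- repetitions, its other elements survive in what is left. The witness `zs` is the complement,
-- which later serves as the list of free cells.
Unique⇒↭ : ∀ {xs ys : List A} → Unique xs → (∀ {x} → x ∈ xs → x ∈ ys) → ∃ λ zs → ys ↭ xs ++ zs
Unique⇒↭ {ys = ys} []          xs⊆ys = ys , ↭.refl
Unique⇒↭ {xs = x ∷ xs} (x∉xs ∷ xs!) xs⊆ys with ∈-∃++ (xs⊆ys (here refl))
... | us , vs , refl with Unique⇒↭ {ys = us ++ vs} xs! xs⊆us++vs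
  where
  xs⊆us++vs : ∀ {y} → y ∈ xs → y ∈ us ++ vs
  xs⊆us++vs y∈xs with ∈-resp-↭ (shift x us vs) (xs⊆ys (there y∈xs))
  ... | here y≡x = contradiction (sym y≡x) (All.lookup x∉xs y∈xs)
  ... | there y∈ = y∈
... | zs , us++vs↭ = zs , ↭-trans (shift x us vs) (↭.prep x us++vs↭)

Unique-⊆⇒length≤ : ∀ {xs ys : List A} → Unique xs → (∀ {x} → x ∈ xs → x ∈ ys) → length xs ≤ length ys
Unique-⊆⇒length≤ {xs = xs} {ys} xs! xs⊆ys with Unique⇒↭ xs! xs⊆ys
... | zs , ys↭ = begin
  length xs              ≤⟨ ℕ.m≤m+n _ _ ⟩
  length xs + length zs  ≡⟨ List.length-++ xs ⟨
  length (xs ++ zs)      ≡⟨ ↭-length ys↭ ⟨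
  length ys              ∎
  where open ℕ.≤-Reasoning

-- The image under `f` of the elements satisfying `P` is a duplicate-free list inside those
-- satisfying `Q`. Equalities of counts are obtained below from a pair of injections in opposite
-- directions.
♯-injection : {P : Pred A p} {Q : Pred A q} (P? : Decidable P) (Q? : Decidable Q) {xs : List A} → Unique xs →
              (f : A → A) → (∀ {x y} → f x ≡ f y → x ≡ y) →
              (∀ {x} → x ∈ xs → P x → f x ∈ xs × Q (f x)) → ♯ P? xs ≤ ♯ Q? xs
♯-injection {P = P} {Q} P? Q? {xs} xs! f f-inj f-resp =
  subst (_≤ ♯ Q? xs) (List.length-map f (filter P? xs))
    (Unique-⊆⇒length≤ (Unique.map⁺ f-inj (Unique.filter⁺ P? xs!)) image⊆)
  where
  image⊆ : ∀ {y} → y ∈ map f (filter P? xs) → y ∈ filter Q? xs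
  image⊆ y∈ with ∈-map⁻ f y∈
  ... | x , x∈ , refl with ∈-filter⁻ P? {xs = xs} x∈
  ...   | x∈xs , px = ∈-filter⁺ Q? (proj₁ (f-resp x∈xs px)) (proj₂ (f-resp x∈xs px))

-- Squares as functions on cells, and permutations of the cells.

infix 8 _at_
-- Cells are indexed through `Vec.concat` because `occurrences` counts along the concatenated rows;
-- a permutation of cells is then just a permutation of one finite index set.
_at_ : Square n → Fin (n * n) → Fin n
w at x = lookup (Vec.concat w) x

at-combine : (w : Square n) (i j : Fin n) → w at combine i j ≡ lookup (lookup w i) j
at-combine w i j = Vec.lookup-concat w i j

lookup-ext : {v w : Vec A n} → (∀ i → lookup v i ≡ lookup w i) → v ≡ w
lookup-ext {v = v} {w} eq =
  trans (sym (Vec.tabulate∘lookup v)) (trans (Vec.tabulate-cong eq) (Vec.tabulate∘lookup w))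

at-ext : {v w : Square n} → (∀ x → v at x ≡ w at x) → v ≡ w
at-ext {v = v} {w} eq = lookup-ext λ i → lookup-ext λ j →
  trans (sym (at-combine v i j)) (trans (eq (combine i j)) (at-combine w i j))

permute : (Fin (n * n) → Fin (n * n)) → Square n → Square n
permute π w = tabulate λ i → tabulate λ j → w at π (combine i j)

permute-at : ∀ (π : Fin (n * n) → Fin (n * n)) (w : Square n) x → permute π w at x ≡ w at π x
permute-at {n} π w x with Fin.combine-surjective {n} {n} x
... | i , j , refl = begin
  permute π w at combine i j          ≡⟨ at-combine (permute π w) i j ⟩
  lookup (lookup (permute π w) i) j   ≡⟨ cong (λ v → lookup v j) (Vec.lookup∘tabulate _ i) ⟩
  lookup (tabulate λ j → w at π (combine i j)) j ≡⟨ Vec.lookup∘tabulate _ j ⟩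
  w at π (combine i j)                ∎
  where open ≡-Reasoning

♯-tail : {P : Pred A p} (P? : Decidable P) (x : A) (v : Vec A n) →
         ♯ (P? ∘ lookup v) (List.allFin n) ≡ ♯ (P? ∘ lookup (x Vec.∷ v)) (List.tabulate suc)
♯-tail P? x v = trans (sym (♯-map (P? ∘ lookup (x Vec.∷ v)) suc (List.allFin _)))
                      (cong (♯ (P? ∘ lookup (x Vec.∷ v))) (List.map-tabulate id suc))

count≡♯ : {P : Pred A p} (P? : Decidable P) (v : Vec A n) →
          Vec.count P? v ≡ ♯ (P? ∘ lookup v) (List.allFin n)
count≡♯         P? Vec.[]      = refl
count≡♯ {n = suc n} P? (x Vec.∷ v) with does (P? x)
... | true  = cong suc (trans (count≡♯ P? v) (♯-tail P? x v))
... | false = trans (count≡♯ P? v) (♯-tail P? x v)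

cells : ∀ n → List (Fin (n * n))
cells n = List.allFin (n * n)

occurrences≡♯ : ∀ s (w : Square n) → occurrences s w ≡ ♯ (λ x → w at x Fin.≟ s) (cells n)
occurrences≡♯ {n} s w = trans (count≡♯ (s Fin.≟_) (Vec.concat w))
  (♯-cong _ _ (cells n) (λ _ → sym) (λ _ → sym))

module _ (π π⁻¹ : Fin (n * n) → Fin (n * n))
         (inverseˡ : ∀ x → π (π⁻¹ x) ≡ x) (inverseʳ : ∀ x → π⁻¹ (π x) ≡ x) where

  permute-injective : ∀ {v w : Square n} → permute {n} π v ≡ permute π w → v ≡ w
  permute-injective {v} {w} eq = at-ext λ x → begin
    v at x                   ≡⟨ cong (v at_) (inverseˡ x) ⟨
    v at π (π⁻¹ x)           ≡⟨ permute-at π v (π⁻¹ x) ⟨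
    permute π v at (π⁻¹ x)   ≡⟨ cong (_at π⁻¹ x) eq ⟩
    permute π w at (π⁻¹ x)   ≡⟨ permute-at π w (π⁻¹ x) ⟩
    w at π (π⁻¹ x)           ≡⟨ cong (w at_) (inverseˡ x) ⟩
    w at x                   ∎
    where open ≡-Reasoning

  -- The map `π` injects the cells carrying `s` in the permuted square into those carrying `s` in
  -- `w`, and `π⁻¹` injects them back.
  occurrences-permute : ∀ s (w : Square n) → occurrences s (permute {n} π w) ≡ occurrences s w
  occurrences-permute s w = begin
    occurrences s (permute π w)                  ≡⟨ occurrences≡♯ s (permute π w) ⟩
    ♯ (λ x → permute π w at x Fin.≟ s) (cells n) ≡⟨ ≤-antisym ≤₁ ≤₂ ⟩
    ♯ (λ x → w at x Fin.≟ s) (cells n)           ≡⟨ occurrences≡♯ s w ⟨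
    occurrences s w                              ∎
    where
    open ≡-Reasoning
    ≤₁ = ♯-injection (λ x → permute π w at x Fin.≟ s) (λ x → w at x Fin.≟ s)
      (Unique.allFin⁺ (n * n)) π
      (λ {x} {y} eq → trans (sym (inverseʳ x)) (trans (cong π⁻¹ eq) (inverseʳ y)))
      (λ {x} _ eq → ∈-allFin _ , trans (sym (permute-at π w x)) eq)
    ≤₂ = ♯-injection (λ x → w at x Fin.≟ s) (λ x → permute π w at x Fin.≟ s)
      (Unique.allFin⁺ (n * n)) π⁻¹
      (λ {x} {y} eq → trans (sym (inverseˡ x)) (trans (cong π eq) (inverseˡ y)))
      (λ {x} _ eq → ∈-allFin _ ,
        trans (permute-at π w (π⁻¹ x)) (trans (cong (w at_) (inverseˡ x)) eq))

  permute-Ω : ∀ {w} → w ∈ Ω n → permute {n} π w ∈ Ω n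
  permute-Ω {w} w∈Ω = Equivalence.from (∈-Ω⇔IsEqui _)
    λ s → trans (occurrences-permute s w) (Equivalence.to (∈-Ω⇔IsEqui w) w∈Ω s)

swap-right : (i j : Fin n) → swap i j j ≡ i
swap-right i j with j Fin.≟ i
-- When `j` equals `i` the first test of `swap` already succeeds and returns `j`, so the goal is
-- `j ≡ i` itself.
... | yes j≡i = j≡i
... | no  _ with j Fin.≟ j
...   | yes _  = refl
...   | no j≢j = contradiction refl j≢j

swap-fixed : {i j k : Fin n} → k ≢ i → k ≢ j → swap i j k ≡ k
swap-fixed {i = i} {j} {k} k≢i k≢j with k Fin.≟ i
... | yes k≡i = contradiction k≡i k≢i
... | no  _ with k Fin.≟ j
...   | yes k≡j = contradiction k≡j k≢j
...   | no  _   = refl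

-- Partial fillings and the number of squares extending them.

Filling : ℕ → Set
Filling n = List (Fin (n * n) × Fin n)

positions : Filling n → List (Fin (n * n))
positions = map proj₁

symbols : Filling n → List (Fin n)
symbols = map proj₂

Extends : Square n → Filling n → Set
Extends w cs = All (λ c → w at proj₁ c ≡ proj₂ c) cs

extends? : (cs : Filling n) → Decidable (λ w → Extends w cs)
extends? cs w = All.all? (λ c → w at proj₁ c Fin.≟ proj₂ c) cs

extensions : Filling n → ℕ
extensions {n} cs = ♯ (extends? cs) (Ω n)

-- Exchanging the contents of `x` and `y` is an injection of `Ω n` into itself. It carries `s` from
-- `x` to `y` and leaves every cell of `cs` alone, since neither `x` nor `y` is among them.
extensions-swap-≤ : ∀ (cs : Filling n) {x y} s → x ∉ positions cs → y ∉ positions cs →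
                    extensions ((x , s) ∷ cs) ≤ extensions ((y , s) ∷ cs)
extensions-swap-≤ {n} cs {x} {y} s x∉cs y∉cs =
  ♯-injection (extends? _) (extends? _) (Ω-unique n) (permute (swap x y))
    (permute-injective (swap x y) (swap y x) (λ _ → swap-inverse x y) (λ _ → swap-inverse y x))
    λ { {w} w∈Ω (wx≡s ∷ ext) →
        permute-Ω (swap x y) (swap y x) (λ _ → swap-inverse x y) (λ _ → swap-inverse y x) w∈Ω ,
        trans (permute-at (swap x y) w y) (trans (cong (w at_) (swap-right x y)) wx≡s) ∷
        All.tabulate λ {c} c∈cs →
          trans (permute-at (swap x y) w (proj₁ c))
          (trans (cong (w at_) (swap-fixed
             (λ eq → x∉cs (subst (_∈ positions cs) eq (∈-map⁺ proj₁ c∈cs)))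
             (λ eq → y∉cs (subst (_∈ positions cs) eq (∈-map⁺ proj₁ c∈cs)))))
          (All.lookup ext c∈cs)) }

extensions-swap : ∀ (cs : Filling n) {x y} s → x ∉ positions cs → y ∉ positions cs →
                  extensions ((x , s) ∷ cs) ≡ extensions ((y , s) ∷ cs)
extensions-swap cs s x∉cs y∉cs =
  ≤-antisym (extensions-swap-≤ cs s x∉cs y∉cs) (extensions-swap-≤ cs s y∉cs x∉cs)

module _ {cs : Filling n} {F : List (Fin (n * n))} (cells↭ : cells n ↭ positions cs ++ F) where

  -- The hypothesis `cells↭` encodes two facts at once: the positions of `cs` are pairwise distinct,
  -- and `F` lists exactly the remaining cells. Both come from `cells n` being duplicate-free, a
  -- property that permutations preserve.
  free∉positions : ∀ {x} → x ∈ F → x ∉ positions cs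
  free∉positions = go (positions cs) (Perm.Unique-resp-↭ (↭.↭⇒↭ₛ cells↭) (Unique.allFin⁺ (n * n)))
    where
    module Perm = Permutation (setoid (Fin (n * n)))
    go : ∀ xs → Unique (xs ++ F) → ∀ {x} → x ∈ F → x ∉ xs
    go (y ∷ xs) (y∉ ∷ _)   x∈F (here refl) = All.lookup y∉ (∈-++⁺ʳ xs x∈F) refl
    go (y ∷ xs) (_ ∷ rest) x∈F (there x∈) = go xs rest x∈F x∈

  -- Of the `n` copies of `s` in `w`, those on filled cells are the ones prescribed by `cs`. The
  -- existence of `w` ensures that the subtraction does not truncate.
  free-occurrences : ∀ {w} s → w ∈ Ω n → Extends w cs →
                     ♯ (λ x → w at x Fin.≟ s) F ≡ n ∸ ♯ (Fin._≟ s) (symbols cs)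
  free-occurrences {w} s w∈Ω ext = begin
    ♯ at? F
      ≡⟨ ℕ.m+n∸m≡n (♯ at? (positions cs)) _ ⟨
    ♯ at? (positions cs) + ♯ at? F ∸ ♯ at? (positions cs)
      ≡⟨ cong₂ _∸_ total filled ⟩
    n ∸ ♯ (Fin._≟ s) (symbols cs)
      ∎
    where
    open ≡-Reasoning
    at? = λ x → w at x Fin.≟ s
    total : ♯ at? (positions cs) + ♯ at? F ≡ n
    total = begin
      ♯ at? (positions cs) + ♯ at? F ≡⟨ ♯-++ at? (positions cs) F ⟨
      ♯ at? (positions cs ++ F)      ≡⟨ ↭-length (filter-↭ at? cells↭) ⟨
      ♯ at? (cells n)                ≡⟨ occurrences≡♯ s w ⟨
      occurrences s w                ≡⟨ Equivalence.to (∈-Ω⇔IsEqui w) w∈Ω s ⟩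
      n                              ∎
    filled : ♯ at? (positions cs) ≡ ♯ (Fin._≟ s) (symbols cs)
    filled = begin
      ♯ at? (positions cs)              ≡⟨ ♯-map at? proj₁ cs ⟩
      ♯ (at? ∘ proj₁) cs                ≡⟨ ♯-cong _ _ cs
                                             (λ c∈cs → trans (sym (All.lookup ext c∈cs)))
                                             (λ c∈cs → trans (All.lookup ext c∈cs)) ⟩
      ♯ ((Fin._≟ s) ∘ proj₂) cs         ≡⟨ ♯-map (Fin._≟ s) proj₂ cs ⟨
      ♯ (Fin._≟ s) (symbols cs)         ∎

  -- Double counting of the pairs (w , y) with w extending cs and carrying s in the
  -- free cell y; by swap symmetry every y contributes as much as x.
  extensions-∷ : ∀ {x} s → x ∈ F →
    length F * extensions ((x , s) ∷ cs) ≡ (n ∸ ♯ (Fin._≟ s) (symbols cs)) * extensions cs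
  extensions-∷ {x} s x∈F = begin
    length F * extensions ((x , s) ∷ cs)
      ≡⟨ ∑-const F _ ⟨
    ∑ F (λ _ → extensions ((x , s) ∷ cs))
      ≡⟨ ∑-cong F (λ y∈F → extensions-swap cs s (free∉positions x∈F) (free∉positions y∈F)) ⟩
    ∑ F (λ y → extensions ((y , s) ∷ cs))
      ≡⟨ ♯-comm (λ y → extends? ((y , s) ∷ cs)) F (Ω n) ⟩
    ∑ (Ω n) (λ w → ♯ (λ y → extends? ((y , s) ∷ cs) w) F)
      ≡⟨ ∑-cong (Ω n) fibre ⟩
    ∑ (Ω n) (λ w → r * 𝟙 (extends? cs w))
      ≡⟨ ∑-distribˡ (Ω n) r _ ⟩
    r * ∑ (Ω n) (𝟙 ∘ extends? cs)
      ≡⟨ cong₂ _*_ {r} refl (♯≡∑ (extends? cs) (Ω n)) ⟨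
    r * extensions cs
      ∎
    where
    open ≡-Reasoning
    r = n ∸ ♯ (Fin._≟ s) (symbols cs)
    fibre : ∀ {w} → w ∈ Ω n → ♯ (λ y → extends? ((y , s) ∷ cs) w) F ≡ r * 𝟙 (extends? cs w)
    fibre {w} w∈Ω = by-cases (extends? cs w)
      where
      by-cases : (ext? : Dec (Extends w cs)) → ♯ (λ y → extends? ((y , s) ∷ cs) w) F ≡ r * 𝟙 ext?
      by-cases (no ¬ext) = trans
        (♯-none (λ y → extends? ((y , s) ∷ cs) w) F (λ _ → ¬ext ∘ All.tail))
        (sym (ℕ.*-zeroʳ r))
      by-cases (yes ext) = begin
        ♯ (λ y → extends? ((y , s) ∷ cs) w) F ≡⟨ ♯-cong _ _ F (λ _ → All.head) (λ _ → _∷ ext) ⟩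
        ♯ (λ y → w at y Fin.≟ s) F            ≡⟨ free-occurrences s w∈Ω ext ⟩
        r                                     ≡⟨ ℕ.*-identityʳ r ⟨
        r * 1                                 ∎

extensions-[] : ∀ n → extensions {n} [] ≡ length (Ω n)
extensions-[] n = ♯-all (extends? []) (Ω n) (λ _ → [])

-- Induction on `cs` with `extensions-∷`. Each prescribed symbol is new, so all `n` copies of it are
-- still to be placed and every cell contributes a factor `n` divided by the current number of free
-- cells. Multiplying out by factorials avoids division.
extensions-distinct-symbols : (cs : Filling n) {F : List (Fin (n * n))} →
  cells n ↭ positions cs ++ F → Unique (symbols cs) →
  extensions cs * (n * n) ! ≡ n ^ length cs * length F ! * length (Ω n)
extensions-distinct-symbols {n} [] {F} cells↭ [] = begin
  extensions {n} [] * (n * n) !   ≡⟨ cong₂ (λ e l → e * l !) (extensions-[] n) n*n≡ ⟩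
  length (Ω n) * length F !       ≡⟨ ring (length (Ω n)) (length F !) ⟩
  1 * length F ! * length (Ω n)   ∎
  where
  open ≡-Reasoning
  n*n≡ : n * n ≡ length F
  n*n≡ = trans (sym (List.length-tabulate id)) (↭-length cells↭)
  ring : ∀ a b → a * b ≡ 1 * b * a
  ring = solve-∀
extensions-distinct-symbols {n} ((x , s) ∷ cs) {F} cells↭ (s∉ ∷ symbols!) =
  -- Before `x` is filled there are `suc f` free cells; this factor turns `f !` into the factorial
  -- in the induction hypothesis and is cancelled afterwards.
  ℕ.*-cancelˡ-≡ _ _ (suc f) (begin
    suc f * (extensions ((x , s) ∷ cs) * N)   ≡⟨ ℕ.*-assoc (suc f) (extensions ((x , s) ∷ cs)) N ⟨
    suc f * extensions ((x , s) ∷ cs) * N     ≡⟨ cong (_* N) (extensions-∷ {cs = cs} cells↭′ s (here refl)) ⟩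
    (n ∸ ♯ (Fin._≟ s) (symbols cs)) * extensions cs * N
      ≡⟨ cong (λ k → (n ∸ k) * extensions cs * N)
           (♯-none (Fin._≟ s) (symbols cs) (λ t∈ t≡s → All.lookup s∉ t∈ (sym t≡s))) ⟩
    n * extensions cs * N                     ≡⟨ ℕ.*-assoc n _ N ⟩
    n * (extensions cs * N)                   ≡⟨ cong₂ _*_ {n} refl (extensions-distinct-symbols cs cells↭′ symbols!) ⟩
    n * (n ^ length cs * (suc f * f !) * length (Ω n))
      ≡⟨ ring n (n ^ length cs) (suc f) (f !) (length (Ω n)) ⟩
    suc f * (n * n ^ length cs * f ! * length (Ω n)) ∎)
  where
  open ≡-Reasoning
  f = length F
  N = (n * n) !
  cells↭′ : cells n ↭ positions cs ++ x ∷ F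
  cells↭′ = ↭-trans cells↭ (↭-sym (shift x (positions cs) F))
  ring : ∀ n k f g l → n * (k * (f * g) * l) ≡ f * (n * k * g * l)
  ring = solve-∀

-- Two uses of `extensions-∷`, with the number of copies still to be placed bounded by `n`. First
-- `y` is filled, out of `2 + length F` free cells, then `x`, out of `1 + length F`.
extensions-∷∷ : ∀ (cs : Filling n) {F x y} s t → cells n ↭ x ∷ y ∷ positions cs ++ F →
  (2 + length F) * (1 + length F) * extensions ((x , s) ∷ (y , t) ∷ cs) ≤ n * n * extensions cs
extensions-∷∷ {n} cs {F} {x} {y} s t cells↭ = begin
  (2 + f) * (1 + f) * E₂        ≡⟨ ℕ.*-assoc (2 + f) (1 + f) E₂ ⟩
  (2 + f) * ((1 + f) * E₂)      ≤⟨ ℕ.*-monoʳ-≤ (2 + f) (fill-≤ {(y , t) ∷ cs} {F} {x} s cells↭) ⟩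
  (2 + f) * (n * E₁)            ≡⟨ ring (2 + f) n E₁ ⟩
  n * ((2 + f) * E₁)            ≤⟨ ℕ.*-monoʳ-≤ n (fill-≤ {cs} {x ∷ F} {y} t cells↭′) ⟩
  n * (n * extensions cs)       ≡⟨ ℕ.*-assoc n n _ ⟨
  n * n * extensions cs         ∎
  where
  open ℕ.≤-Reasoning
  f  = length F
  E₁ = extensions ((y , t) ∷ cs)
  E₂ = extensions ((x , s) ∷ (y , t) ∷ cs)
  fill-≤ : ∀ {cs : Filling n} {F x} s → cells n ↭ x ∷ positions cs ++ F →
           (1 + length F) * extensions ((x , s) ∷ cs) ≤ n * extensions cs
  fill-≤ {cs} {F} {x} s cells↭ = begin
    (1 + length F) * extensions ((x , s) ∷ cs)
      ≡⟨ extensions-∷ (↭-trans cells↭ (↭-sym (shift x (positions cs) F))) s (here refl) ⟩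
    (n ∸ ♯ (Fin._≟ s) (symbols cs)) * extensions cs
      ≤⟨ ℕ.*-monoˡ-≤ (extensions cs) (ℕ.m∸n≤m n (♯ (Fin._≟ s) (symbols cs))) ⟩
    n * extensions cs
      ∎
  cells↭′ : cells n ↭ y ∷ positions cs ++ x ∷ F
  cells↭′ = ↭-trans cells↭ (↭-trans (↭.swap x y ↭.refl)
              (↭.prep y (↭-sym (shift x (positions cs) F))))
  ring : ∀ a b c → a * (b * c) ≡ b * (a * c)
  ring = solve-∀

-- Union bound and Bonferroni inequality.

module _ {E : A → Pred B q} (E? : ∀ x → Decidable (E x)) (ws : List B) where

  any-of? : ∀ xs → Decidable (λ w → Any (λ x → E x w) xs)
  any-of? xs w = Any.any? (λ x → E? x w) xs

  any-of-∷ : ∀ x xs → ♯ (any-of? (x ∷ xs)) ws ≡ ♯ (λ w → E? x w ⊎-dec any-of? xs w) ws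
  any-of-∷ x xs = ♯-cong (any-of? (x ∷ xs)) (λ w → E? x w ⊎-dec any-of? xs w) ws
    (λ _ → Any.toSum) (λ _ → Any.fromSum)

  union-bound : ∀ xs → ♯ (any-of? xs) ws ≤ ∑ xs (λ x → ♯ (E? x) ws)
  union-bound []       = ≤-reflexive (♯-none (any-of? []) ws (λ _ ()))
  union-bound (x ∷ xs) = begin
    ♯ (any-of? (x ∷ xs)) ws
      ≡⟨ any-of-∷ x xs ⟩
    ♯ (λ w → E? x w ⊎-dec any-of? xs w) ws
      ≤⟨ ℕ.m≤m+n _ (♯ (λ w → E? x w ×-dec any-of? xs w) ws) ⟩
    ♯ (λ w → E? x w ⊎-dec any-of? xs w) ws + ♯ (λ w → E? x w ×-dec any-of? xs w) ws
      ≡⟨ ♯-inclusion-exclusion (E? x) (any-of? xs) ws ⟨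
    ♯ (E? x) ws + ♯ (any-of? xs) ws
      ≤⟨ ℕ.+-monoʳ-≤ (♯ (E? x) ws) (union-bound xs) ⟩
    ∑ (x ∷ xs) (λ x → ♯ (E? x) ws)
      ∎
    where open ℕ.≤-Reasoning

-- Induction on `xs`: adding the event of `x` to a union loses only the overlap of the two, which is
-- at most the sum of the pairwise overlaps with `x`. The factor `K` clears the denominator of the
-- pairwise bound `C / K`, and the number of pairs is bounded crudely by the square of the length.
bonferroni : {E : A → Pred B q} (E? : ∀ x → Decidable (E x)) (ws : List B) (K C : ℕ) →
  (∀ {x y} → x ≢ y → K * ♯ (λ w → E? x w ×-dec E? y w) ws ≤ C) →
  ∀ {xs} → Unique xs →
  K * ∑ xs (λ x → ♯ (E? x) ws) ≤ K * ♯ (any-of? E? ws xs) ws + length xs * length xs * C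
bonferroni E? ws K C pair {[]}     []            = ≤-trans (≤-reflexive (ℕ.*-zeroʳ K)) z≤n
bonferroni E? ws K C pair {x ∷ xs} (x∉xs ∷ xs!) = begin
  K * (e + s)                    ≡⟨ ℕ.*-distribˡ-+ K e s ⟩
  K * e + K * s                  ≤⟨ ℕ.+-monoʳ-≤ (K * e) (bonferroni E? ws K C pair xs!) ⟩
  K * e + (K * u + l * l * C)    ≡⟨ ring₁ K e u (l * l * C) ⟩
  K * (e + u) + l * l * C        ≡⟨ cong (λ t → K * t + l * l * C) (♯-inclusion-exclusion (E? x) (any-of? E? ws xs) ws) ⟩
  K * (v + i) + l * l * C        ≡⟨ ring₂ K v i (l * l * C) ⟩
  K * v + (K * i + l * l * C)    ≤⟨ ℕ.+-monoʳ-≤ (K * v) (ℕ.+-monoˡ-≤ (l * l * C) intersection) ⟩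
  -- The surplus `suc l * C` completes `l + l * l` to the square of `suc l`.
  K * v + (l * C + l * l * C)    ≤⟨ ℕ.+-monoʳ-≤ (K * v) (ℕ.m≤m+n _ (suc l * C)) ⟩
  K * v + (l * C + l * l * C + suc l * C) ≡⟨ cong₂ (λ t r → K * t + r) (sym (any-of-∷ E? ws x xs)) (ring₃ l C) ⟩
  K * ♯ (any-of? E? ws (x ∷ xs)) ws + suc l * suc l * C ∎
  where
  open ℕ.≤-Reasoning
  l = length xs
  e = ♯ (E? x) ws
  s = ∑ xs (λ y → ♯ (E? y) ws)
  u = ♯ (any-of? E? ws xs) ws
  v = ♯ (λ w → E? x w ⊎-dec any-of? E? ws xs w) ws
  i = ♯ (λ w → E? x w ×-dec any-of? E? ws xs w) ws
  both? = λ y w → E? x w ×-dec E? y w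
  intersection : K * i ≤ l * C
  intersection = begin
    K * i
      -- The overlap of `E x` with a union is itself the union of the events `both? y`, so the union
      -- bound applies to it.
      ≤⟨ ℕ.*-monoʳ-≤ K (♯-mono (λ w → E? x w ×-dec any-of? E? ws xs w) (any-of? both? ws xs) ws
           (λ _ (ex , any) → Any.map (ex ,_) any)) ⟩
    K * ♯ (any-of? both? ws xs) ws
      ≤⟨ ℕ.*-monoʳ-≤ K (union-bound both? ws xs) ⟩
    K * ∑ xs (λ y → ♯ (both? y) ws)
      ≡⟨ ∑-distribˡ xs K _ ⟨
    ∑ xs (λ y → K * ♯ (both? y) ws)
      ≤⟨ ∑-mono xs (λ y∈xs → pair (All.lookup x∉xs y∈xs)) ⟩
    ∑ xs (λ _ → C)
      ≡⟨ ∑-const xs C ⟩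
    l * C
      ∎
  ring₁ : ∀ K e u r → K * e + (K * u + r) ≡ K * (e + u) + r
  ring₁ = solve-∀
  ring₂ : ∀ K v i r → K * (v + i) + r ≡ K * v + (K * i + r)
  ring₂ = solve-∀
  ring₃ : ∀ l C → l * C + l * l * C + suc l * C ≡ suc l * suc l * C
  ring₃ = solve-∀

length-cartesianProduct : ∀ (xs : List A) (ys : List B) →
  length (List.cartesianProduct xs ys) ≡ length xs * length ys
length-cartesianProduct []       ys = refl
length-cartesianProduct (x ∷ xs) ys = begin
  length (map (x ,_) ys ++ List.cartesianProduct xs ys)
    ≡⟨ List.length-++ (map (x ,_) ys) ⟩
  length (map (x ,_) ys) + length (List.cartesianProduct xs ys)
    ≡⟨ cong₂ _+_ (List.length-map (x ,_) ys) (length-cartesianProduct xs ys) ⟩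
  length ys + length xs * length ys
    ∎
  where open ≡-Reasoning

-- Transposed and reversed vectors.

lookup-transpose : (vs : Vec (Vec A n) m) (i : Fin m) (j : Fin n) →
                   lookup (lookup (Vec.transpose vs) j) i ≡ lookup (lookup vs i) j
lookup-transpose {n = n} (v Vec.∷ vs) i j = trans (cong (λ u → lookup u i) column≡) (head-or-tail i)
  where
  column≡ : lookup (Vec.transpose (v Vec.∷ vs)) j ≡ lookup v j Vec.∷ lookup (Vec.transpose vs) j
  column≡ = trans (Vec.lookup-⊛ j (Vec.replicate n Vec._∷_ Vec.⊛ v) (Vec.transpose vs))
    (cong (λ f → f (lookup (Vec.transpose vs) j))
      (trans (Vec.lookup-⊛ j (Vec.replicate n Vec._∷_) v)
             (cong (λ f → f (lookup v j)) (Vec.lookup-replicate j Vec._∷_))))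
  head-or-tail : ∀ i → lookup (lookup v j Vec.∷ lookup (Vec.transpose vs) j) i ≡
                       lookup (lookup (v Vec.∷ vs) i) j
  head-or-tail zero    = refl
  head-or-tail (suc i) = lookup-transpose vs i j

tabulate-∷ʳ : (f : Fin (suc n) → A) → tabulate f ≡ tabulate (f ∘ inject₁) Vec.∷ʳ f (fromℕ n)
tabulate-∷ʳ {n = zero}  f = refl
tabulate-∷ʳ {n = suc n} f = cong (f zero Vec.∷_) (tabulate-∷ʳ (f ∘ suc))

opposite-injective : {i j : Fin n} → opposite i ≡ opposite j → i ≡ j
opposite-injective {i = i} {j} eq =
  trans (sym (Fin.opposite-involutive i)) (trans (cong opposite eq) (Fin.opposite-involutive j))

opposite-inject₁ : (i : Fin n) → opposite (inject₁ i) ≡ suc (opposite i)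
opposite-inject₁ i = opposite-injective
  (trans (Fin.opposite-involutive (inject₁ i)) (cong inject₁ (sym (Fin.opposite-involutive i))))

opposite-fromℕ : ∀ n → opposite (fromℕ n) ≡ zero
-- By definition `opposite zero` is `fromℕ n`, so involutivity at `zero` is exactly the claim.
opposite-fromℕ n = Fin.opposite-involutive {suc n} zero

-- Brings `reverse (allFin n)` into the form `tabulate opposite`, so that decreasing lines can be
-- compared entry by entry.
reverse-tabulate : (f : Fin n → A) → Vec.reverse (tabulate f) ≡ tabulate (f ∘ opposite)
reverse-tabulate {n = zero}  f = refl
reverse-tabulate {n = suc n} f = begin
  Vec.reverse (f zero Vec.∷ tabulate (f ∘ suc))    ≡⟨ Vec.reverse-∷ (f zero) (tabulate (f ∘ suc)) ⟩
  Vec.reverse (tabulate (f ∘ suc)) Vec.∷ʳ f zero   ≡⟨ cong (Vec._∷ʳ f zero) (reverse-tabulate (f ∘ suc)) ⟩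
  tabulate (f ∘ suc ∘ opposite) Vec.∷ʳ f zero      ≡⟨ cong₂ Vec._∷ʳ_
                                                        (Vec.tabulate-cong (cong f ∘ sym ∘ opposite-inject₁))
                                                        (cong f (sym (opposite-fromℕ n))) ⟩
  tabulate (f ∘ opposite ∘ inject₁) Vec.∷ʳ f (opposite (fromℕ n)) ≡⟨ tabulate-∷ʳ (f ∘ opposite) ⟨
  tabulate (f ∘ opposite)                          ∎
  where open ≡-Reasoning

-- Consecutive lines as fillings.

data Orientation : Set where
  horizontal vertical : Orientation

data Direction : Set where
  increasing decreasing : Direction

Line : ℕ → Set
Line n = Orientation × Direction × Fin n

cell : Orientation → Fin n → Fin n → Fin (n * n)
cell horizontal i k = combine i k
cell vertical   i k = combine k i

symbol : Direction → Fin n → Fin n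
symbol increasing k = k
symbol decreasing k = opposite k

filling : Line n → Filling n
filling (o , d , i) = map (λ k → cell o i k , symbol d k) (List.allFin _)

cell-injective : ∀ o (i : Fin n) {k l} → cell o i k ≡ cell o i l → k ≡ l
cell-injective horizontal i eq = Fin.combine-injectiveʳ i _ i _ eq
cell-injective vertical   i eq = Fin.combine-injectiveˡ _ i _ i eq

symbol-injective : ∀ d {k l : Fin n} → symbol d k ≡ symbol d l → k ≡ l
symbol-injective increasing eq = eq
symbol-injective decreasing eq = opposite-injective eq

positions-filling : ∀ o d (i : Fin n) → positions (filling (o , d , i)) ≡ map (cell o i) (List.allFin n)
positions-filling o d i = sym (List.map-∘ (List.allFin _))

positions-filling-unique : (ℓ : Line n) → Unique (positions (filling ℓ))
positions-filling-unique (o , d , i) = subst Unique (sym (positions-filling o d i))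
  (Unique.map⁺ (cell-injective o i) (Unique.allFin⁺ _))

symbols-filling-unique : (ℓ : Line n) → Unique (symbols (filling ℓ))
symbols-filling-unique (o , d , i) = subst Unique (List.map-∘ (List.allFin _))
  (Unique.map⁺ (symbol-injective d) (Unique.allFin⁺ _))

length-filling : (ℓ : Line n) → length (filling ℓ) ≡ n
length-filling {n} ℓ = trans (List.length-map _ (List.allFin n)) (List.length-tabulate id)

length-positions-filling : (ℓ : Line n) → length (positions (filling ℓ)) ≡ n
length-positions-filling ℓ = trans (List.length-map proj₁ (filling ℓ)) (length-filling ℓ)

orientations : List Orientation
orientations = horizontal ∷ vertical ∷ []

directions : List Direction
directions = increasing ∷ decreasing ∷ []

lines : ∀ n → List (Line n)
lines n = List.cartesianProduct orientations (List.cartesianProduct directions (List.allFin n))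

∈-lines : (ℓ : Line n) → ℓ ∈ lines n
∈-lines (o , d , i) = ∈-cartesianProduct⁺ (∈-orientations o)
  (∈-cartesianProduct⁺ (∈-directions d) (∈-allFin i))
  where
  ∈-orientations : ∀ o → o ∈ orientations
  ∈-orientations horizontal = here refl
  ∈-orientations vertical   = there (here refl)
  ∈-directions : ∀ d → d ∈ directions
  ∈-directions increasing = here refl
  ∈-directions decreasing = there (here refl)

lines-unique : ∀ n → Unique (lines n)
lines-unique n = Unique.cartesianProduct⁺ (((λ ()) ∷ []) ∷ [] ∷ [])
  (Unique.cartesianProduct⁺ (((λ ()) ∷ []) ∷ [] ∷ []) (Unique.allFin⁺ n))

length-lines : ∀ n → length (lines n) ≡ 4 * n
length-lines n = begin
  length (lines n)                ≡⟨ length-cartesianProduct orientations (List.cartesianProduct directions (List.allFin n)) ⟩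
  2 * length (List.cartesianProduct directions (List.allFin n))
                                  ≡⟨ cong (2 *_) (length-cartesianProduct directions (List.allFin n)) ⟩
  2 * (2 * length (List.allFin n)) ≡⟨ cong (λ l → 2 * (2 * l)) (List.length-tabulate {n = n} id) ⟩
  2 * (2 * n)                     ≡⟨ ℕ.*-assoc 2 2 n ⟨
  4 * n                           ∎
  where open ≡-Reasoning

IsLine : Line n → Square n → Set
IsLine ℓ w = Extends w (filling ℓ)

isLine? : (ℓ : Line n) → Decidable (IsLine ℓ)
isLine? ℓ = extends? (filling ℓ)

line : Orientation → Square n → Fin n → Vec (Fin n) n
line horizontal = row
line vertical   = column

lookup-line : ∀ o (w : Square n) i k → lookup (line o w i) k ≡ w at cell o i k
lookup-line horizontal w i k = sym (at-combine w i k)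
lookup-line vertical   w i k = trans (lookup-transpose w k i) (sym (at-combine w k i))

target : Direction → Vec (Fin n) n
target d = tabulate (symbol d)

IsLine⇒ : ∀ o d i (w : Square n) → IsLine (o , d , i) w → line o w i ≡ target d
IsLine⇒ o d i w ext = lookup-ext λ k → begin
  lookup (line o w i) k ≡⟨ lookup-line o w i k ⟩
  w at cell o i k       ≡⟨ All.lookup ext (∈-map⁺ (λ k → cell o i k , symbol d k) (∈-allFin k)) ⟩
  symbol d k            ≡⟨ Vec.lookup∘tabulate (symbol d) k ⟨
  lookup (target d) k   ∎
  where open ≡-Reasoning

IsLine⇐ : ∀ o d i (w : Square n) → line o w i ≡ target d → IsLine (o , d , i) w
IsLine⇐ o d i w eq = All.tabulate λ c∈ → by-cell (∈-map⁻ _ c∈)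
  where
  by-cell : ∀ {c} → (∃ λ k → k ∈ List.allFin _ × c ≡ (cell o i k , symbol d k)) → w at proj₁ c ≡ proj₂ c
  by-cell (k , _ , refl) =
    trans (sym (lookup-line o w i k)) (trans (cong (λ v → lookup v k) eq) (Vec.lookup∘tabulate (symbol d) k))

ConsecutiveLine⇔target : (v : Vec (Fin n) n) → ConsecutiveLine v ⇔ (∃ λ d → v ≡ target d)
ConsecutiveLine⇔target v = mk⇔
  (λ { (inj₁ eq) → increasing , eq
     ; (inj₂ eq) → decreasing , trans eq (reverse-tabulate id) })
  (λ { (increasing , eq) → inj₁ eq
     ; (decreasing , eq) → inj₂ (trans eq (sym (reverse-tabulate id))) })

-- With its converse below, this presents the consecutive squares as a union of `4 * n` events
-- indexed by a duplicate-free list, the form required by `union-bound` and `bonferroni`.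
IsConsecutive⇒Any : (w : Square n) → IsConsecutive w → Any (λ ℓ → IsLine ℓ w) (lines n)
IsConsecutive⇒Any {n} w = λ { (inj₁ (i , c)) → from-line horizontal i c
                            ; (inj₂ (j , c)) → from-line vertical j c }
  where
  from-line : ∀ o i → ConsecutiveLine (line o w i) → Any (λ ℓ → IsLine ℓ w) (lines n)
  from-line o i c with Equivalence.to (ConsecutiveLine⇔target _) c
  ... | d , eq = lose (∈-lines (o , d , i)) (IsLine⇐ o d i w eq)

Any⇒IsConsecutive : (w : Square n) → Any (λ ℓ → IsLine ℓ w) (lines n) → IsConsecutive w
Any⇒IsConsecutive w any with find any
... | (o , d , i) , _ , ext = to-line o (Equivalence.from (ConsecutiveLine⇔target _) (d , IsLine⇒ o d i w ext))
  where
  to-line : ∀ o → ConsecutiveLine (line o w i) → IsConsecutive w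
  to-line horizontal c = inj₁ (i , c)
  to-line vertical   c = inj₂ (i , c)

-- A line prescribes `n` distinct symbols in `n` distinct cells, so `extensions-distinct-symbols`
-- applies with the complement of its cells as free cells.
extensions-line : (ℓ : Line n) →
  extensions (filling ℓ) * (n * n) ! ≡ n ^ n * (n * n ∸ n) ! * length (Ω n)
extensions-line {n} ℓ with Unique⇒↭ (positions-filling-unique ℓ) (λ {x} _ → ∈-allFin x)
... | F , cells↭ = trans (extensions-distinct-symbols (filling ℓ) cells↭ (symbols-filling-unique ℓ))
  (cong₂ (λ k f → n ^ k * f ! * length (Ω n)) (length-filling ℓ) length-F)
  where
  length-F : length F ≡ n * n ∸ n
  length-F = begin
    length F                                            ≡⟨ ℕ.m+n∸m≡n n (length F) ⟨
    n + length F ∸ n                                    ≡⟨ cong (λ k → k + length F ∸ n) (length-positions-filling ℓ) ⟨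
    length (positions (filling ℓ)) + length F ∸ n       ≡⟨ cong (_∸ n) (List.length-++ (positions (filling ℓ))) ⟨
    length (positions (filling ℓ) ++ F) ∸ n             ≡⟨ cong (_∸ n) (↭-length cells↭) ⟨
    length (cells n) ∸ n                                ≡⟨ cong (_∸ n) (List.length-tabulate {n = n * n} id) ⟩
    n * n ∸ n                                           ∎
    where open ≡-Reasoning

-- Pairs of distinct lines.

OffLine : Orientation × Fin n → Orientation × Fin n → Fin n → Set
OffLine (o , i) (o′ , i′) j = ∀ k → cell o′ i′ j ≢ cell o i k

-- Distinct parallel lines are disjoint, so any two cells will do. A row and a column meet in one
-- cell, whose index along the second line is `i`; `punchIn i` skips that index, and size at least 3
-- leaves two others.
two-off-line : ∀ (o o′ : Orientation) (i i′ : Fin (3 + m)) → (o , i) ≢ (o′ , i′) →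
  ∃₂ λ j k → j ≢ k × OffLine (o , i) (o′ , i′) j × OffLine (o , i) (o′ , i′) k
two-off-line horizontal horizontal i i′ ≢ =
  zero , suc zero , (λ ()) , off zero , off (suc zero)
  where
  off : ∀ j → OffLine (horizontal , i) (horizontal , i′) j
  off j k eq = ≢ (cong (horizontal ,_) (sym (Fin.combine-injectiveˡ i′ j i k eq)))
two-off-line vertical vertical i i′ ≢ =
  zero , suc zero , (λ ()) , off zero , off (suc zero)
  where
  off : ∀ j → OffLine (vertical , i) (vertical , i′) j
  off j k eq = ≢ (cong (vertical ,_) (sym (Fin.combine-injectiveʳ j i′ k i eq)))
two-off-line horizontal vertical i i′ _ =
  punchIn i zero , punchIn i (suc zero) , (λ eq → Fin.0≢1+n (Fin.punchIn-injective i _ _ eq)) ,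
  off zero , off (suc zero)
  where
  off : ∀ j → OffLine (horizontal , i) (vertical , i′) (punchIn i j)
  off j k eq = Fin.punchInᵢ≢i i j (Fin.combine-injectiveˡ (punchIn i j) i′ i k eq)
two-off-line vertical horizontal i i′ _ =
  punchIn i zero , punchIn i (suc zero) , (λ eq → Fin.0≢1+n (Fin.punchIn-injective i _ _ eq)) ,
  off zero , off (suc zero)
  where
  off : ∀ j → OffLine (vertical , i) (horizontal , i′) (punchIn i j)
  off j k eq = Fin.punchInᵢ≢i i j (Fin.combine-injectiveʳ i′ (punchIn i j) k i eq)

infix 4 _≟ₒ_ _≟ₗ_
_≟ₒ_ : (o o′ : Orientation) → Dec (o ≡ o′)
horizontal ≟ₒ horizontal = yes refl
horizontal ≟ₒ vertical   = no λ ()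
vertical   ≟ₒ horizontal = no λ ()
vertical   ≟ₒ vertical   = yes refl

_≟ₗ_ : (x y : Orientation × Fin n) → Dec (x ≡ y)
_≟ₗ_ = ×.≡-dec _≟ₒ_ Fin._≟_

-- From size 2 on, the first entries differ, being the least and the greatest symbol; at size 1 the
-- two targets coincide.
target-injective : ∀ d d′ → target {2 + m} d ≡ target d′ → d ≡ d′
target-injective increasing increasing _  = refl
target-injective increasing decreasing eq = contradiction (cong Vec.head eq) λ ()
target-injective decreasing increasing eq = contradiction (cong Vec.head eq) λ ()
target-injective decreasing decreasing _  = refl

both? : (ℓ ℓ′ : Line n) → Decidable (λ w → IsLine ℓ w × IsLine ℓ′ w)
both? ℓ ℓ′ w = isLine? ℓ w ×-dec isLine? ℓ′ w

same-line-disjoint : ∀ o (i : Fin (2 + m)) {d d′} → d ≢ d′ →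
  ♯ (both? (o , d , i) (o , d′ , i)) (Ω (2 + m)) ≡ 0
same-line-disjoint o i {d} {d′} d≢d′ = ♯-none (both? (o , d , i) (o , d′ , i)) (Ω _)
  λ {w} _ (ext , ext′) →
    d≢d′ (target-injective d d′ (trans (sym (IsLine⇒ o d i w ext)) (IsLine⇒ o d′ i w ext′)))

-- Two of the cells of the second line are already enough for the bound.
distinct-lines-bound : ∀ {f} → n * n ≡ 2 + (n + f) → ∀ (o o′ : Orientation) d d′ (i i′ : Fin n) {j k} →
  j ≢ k → OffLine (o , i) (o′ , i′) j → OffLine (o , i) (o′ , i′) k →
  (2 + f) * (1 + f) * ♯ (both? (o , d , i) (o′ , d′ , i′)) (Ω n) ≤
  n * n * extensions (filling (o , d , i))
distinct-lines-bound {n} {f} f-def o o′ d d′ i i′ {j} {k} j≢k off-j off-k = begin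
  K * ♯ (both? ℓ ℓ′) (Ω n)
    ≤⟨ ℕ.*-monoʳ-≤ K (♯-mono (both? ℓ ℓ′) (extends? cs) (Ω n) two-cells) ⟩
  (2 + f) * (1 + f) * extensions cs
    ≡⟨ cong (λ f → (2 + f) * (1 + f) * extensions cs) length-F ⟨
  (2 + length F) * (1 + length F) * extensions cs
    ≤⟨ extensions-∷∷ (filling ℓ) (symbol d′ j) (symbol d′ k) cells↭ ⟩
  n * n * extensions (filling ℓ)
    ∎
  where
  open ℕ.≤-Reasoning
  K  = (2 + f) * (1 + f)
  ℓ  = o , d , i
  ℓ′ = o′ , d′ , i′
  cs : Filling n
  cs = (cell o′ i′ j , symbol d′ j) ∷ (cell o′ i′ k , symbol d′ k) ∷ filling ℓ
  off⇒∉ : ∀ {j} → OffLine (o , i) (o′ , i′) j → All (cell o′ i′ j ≢_) (positions (filling ℓ))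
  off⇒∉ {j} off = subst (All (cell o′ i′ j ≢_)) (sym (positions-filling o d i))
    (All.map⁺ (All.tabulate λ {k} _ → off k))
  unique : Unique (positions cs)
  unique = ((j≢k ∘ cell-injective o′ i′) ∷ off⇒∉ off-j) ∷ off⇒∉ off-k ∷ positions-filling-unique ℓ
  complement : ∃ λ F → cells n ↭ positions cs ++ F
  complement = Unique⇒↭ unique (λ {x} _ → ∈-allFin x)
  F      = proj₁ complement
  cells↭ = proj₂ complement
  two-cells : ∀ {w} → w ∈ Ω n → IsLine ℓ w × IsLine ℓ′ w → Extends w cs
  two-cells _ (ext , ext′) = at j ∷ at k ∷ ext
    where
    at = λ k → All.lookup ext′ (∈-map⁺ (λ k → cell o′ i′ k , symbol d′ k) (∈-allFin k))
  length-F : length F ≡ f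
  length-F = ℕ.+-cancelˡ-≡ (2 + n) _ _ (begin-equality
    2 + (n + length F)            ≡⟨ cong (λ l → 2 + (l + length F)) (length-positions-filling ℓ) ⟨
    2 + (length (positions (filling ℓ)) + length F)
                                  ≡⟨ List.length-++ (positions cs) ⟨
    length (positions cs ++ F)    ≡⟨ ↭-length cells↭ ⟨
    length (cells n)              ≡⟨ List.length-tabulate {n = n * n} id ⟩
    n * n                         ≡⟨ f-def ⟩
    2 + (n + f)                   ∎)

-- Here `f` is n² - n - 2, so the left factor is (n² - n)(n² - n - 1). Opposite directions on the
-- same row or column exclude each other; otherwise `two-off-line` supplies two further cells to
-- prescribe.
pair-bound : ∀ {f} (let n = 3 + m) → n * n ≡ 2 + (n + f) → (ℓ ℓ′ : Line n) → ℓ ≢ ℓ′ →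
  (2 + f) * (1 + f) * ♯ (both? ℓ ℓ′) (Ω n) ≤ n * n * extensions (filling ℓ)
pair-bound {m} {f} f-def (o , d , i) (o′ , d′ , i′) ℓ≢ℓ′ = by-cases ((o , i) ≟ₗ (o′ , i′))
  where
  K : ℕ
  K = (2 + f) * (1 + f)
  by-cases : Dec ((o , i) ≡ (o′ , i′)) →
    K * ♯ (both? (o , d , i) (o′ , d′ , i′)) (Ω (3 + m)) ≤ (3 + m) * (3 + m) * extensions (filling (o , d , i))
  by-cases (yes refl) = ≤-trans
    (≤-reflexive (trans (cong (K *_) (same-line-disjoint o i λ d≡d′ → ℓ≢ℓ′ (cong (λ d → o , d , i) d≡d′)))
                        (ℕ.*-zeroʳ K)))
    z≤n
  by-cases (no oi≢o′i′) =
    let _ , _ , j≢k , off-j , off-k = two-off-line o o′ i i′ oi≢o′i′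
    in distinct-lines-bound f-def o o′ d d′ i i′ j≢k off-j off-k

-- Upper and lower bounds for the number of consecutive squares.

consecutive : ℕ → ℕ
consecutive n = ♯ isConsecutive? (Ω n)

ℓ₀ : Line (suc n)
ℓ₀ = horizontal , increasing , zero

module _ (m : ℕ) where

  private
    N S T f K : ℕ
    N = 3 + m
    S = extensions (filling (ℓ₀ {2 + m}))
    T = 4 * N * S
    -- This is N² - N - 2 expanded in `m`, free of subtraction; hence `K` is (N² - N)(N² - N - 1).
    f = m * m + 5 * m + 4
    K = (2 + f) * (1 + f)

    -- The right side of `extensions-line` is the same for all lines, so `ℓ₀` can represent them
    -- once the factorial is cancelled.
    S≡ : ∀ (ℓ : Line N) → extensions (filling ℓ) ≡ S
    S≡ ℓ = ℕ.*-cancelʳ-≡ _ _ ((N * N) !) {{(N * N) !≢0}}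
      (trans (extensions-line ℓ) (sym (extensions-line (ℓ₀ {2 + m}))))

    ∑S≡T : ∑ (lines N) (λ ℓ → ♯ (isLine? ℓ) (Ω N)) ≡ T
    ∑S≡T = trans (∑-cong (lines N) {λ ℓ → ♯ (isLine? ℓ) (Ω N)} {λ _ → S} (λ {ℓ} _ → S≡ ℓ))
      (trans (∑-const (lines N) S) (cong (_* S) (length-lines N)))

    consecutive≡ : consecutive N ≡ ♯ (any-of? isLine? (Ω N) (lines N)) (Ω N)
    consecutive≡ = ♯-cong isConsecutive? (any-of? isLine? (Ω N) (lines N)) (Ω N)
      (λ {w} _ → IsConsecutive⇒Any w) (λ {w} _ → Any⇒IsConsecutive w)

    -- For N at least 3 both factors of `K` are at least N²/2. The two added polynomials are the
    -- differences `2 * (2 + f)` minus N² and `2 * (1 + f)` minus N².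
    N⁴≤4K : (N * N) * (N * N) ≤ 4 * K
    N⁴≤4K = begin
      (N * N) * (N * N)              ≤⟨ ℕ.*-mono-≤ (ℕ.m≤m+n (N * N) (m * m + 4 * m + 3))
                                                   (ℕ.m≤m+n (N * N) (m * m + 4 * m + 1)) ⟩
      (N * N + (m * m + 4 * m + 3)) * (N * N + (m * m + 4 * m + 1)) ≡⟨ ring m ⟩
      4 * K                          ∎
      where
      open ℕ.≤-Reasoning
      ring : ∀ m → ((3 + m) * (3 + m) + (m * m + 4 * m + 3)) *
              ((3 + m) * (3 + m) + (m * m + 4 * m + 1))
                   ≡ 4 * ((2 + (m * m + 5 * m + 4)) * (1 + (m * m + 5 * m + 4)))
      ring = solve-∀

    N²≡2+N+f : N * N ≡ 2 + (N + f)
    N²≡2+N+f = ring m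
      where
      ring : ∀ m → (3 + m) * (3 + m) ≡ 2 + (3 + m + (m * m + 5 * m + 4))
      ring = solve-∀

  consecutive-≤ : consecutive N ≤ T
  consecutive-≤ = begin
    consecutive N                                  ≡⟨ consecutive≡ ⟩
    ♯ (any-of? isLine? (Ω N) (lines N)) (Ω N)      ≤⟨ union-bound isLine? (Ω N) (lines N) ⟩
    ∑ (lines N) (λ ℓ → ♯ (isLine? ℓ) (Ω N))        ≡⟨ ∑S≡T ⟩
    T                                              ∎
    where open ℕ.≤-Reasoning

  -- A relative error of at most 16 / N, without division. The Bonferroni error is (4N)² N² S;
  -- multiplied by `N` it becomes 4 N⁴ T, which `N⁴≤4K` bounds by 16 K T, and `K` cancels.
  consecutive-≥ : N * T ≤ N * consecutive N + 16 * T
  consecutive-≥ = ℕ.*-cancelˡ-≤ K (begin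
    K * (N * T)
      ≡⟨ ring₁ K N T ⟩
    N * (K * T)
      ≡⟨ cong (λ t → N * (K * t)) ∑S≡T ⟨
    N * (K * ∑ (lines N) (λ ℓ → ♯ (isLine? ℓ) (Ω N)))
      ≤⟨ ℕ.*-monoʳ-≤ N (bonferroni isLine? (Ω N) K (N * N * S) pair (lines-unique N)) ⟩
    N * (K * ♯ (any-of? isLine? (Ω N) (lines N)) (Ω N) + length (lines N) * length (lines N) * (N * N * S))
      ≡⟨ cong₂ (λ a l → N * (K * a + l * l * (N * N * S))) (sym consecutive≡) (length-lines N) ⟩
    N * (K * c + 4 * N * (4 * N) * (N * N * S))
      ≡⟨ ring₂ N K c S ⟩
    K * (N * c) + 4 * ((N * N) * (N * N)) * T
      ≤⟨ ℕ.+-monoʳ-≤ (K * (N * c)) (ℕ.*-monoˡ-≤ T (ℕ.*-monoʳ-≤ 4 N⁴≤4K)) ⟩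
    K * (N * c) + 4 * (4 * K) * T
      ≡⟨ ring₃ K (N * c) T ⟩
    K * (N * c + 16 * T)
      ∎)
    where
    open ℕ.≤-Reasoning
    c = consecutive N
    pair : ∀ {ℓ ℓ′} → ℓ ≢ ℓ′ → K * ♯ (both? ℓ ℓ′) (Ω N) ≤ N * N * S
    pair {ℓ} {ℓ′} ℓ≢ℓ′ = ≤-trans (pair-bound N²≡2+N+f ℓ ℓ′ ℓ≢ℓ′) (≤-reflexive (cong (N * N *_) (S≡ ℓ)))
    ring₁ : ∀ K n T → K * (n * T) ≡ n * (K * T)
    ring₁ = solve-∀
    ring₂ : ∀ n K c S → n * (K * c + 4 * n * (4 * n) * (n * n * S)) ≡
                        K * (n * c) + 4 * ((n * n) * (n * n)) * (4 * n * S)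
    ring₂ = solve-∀
    ring₃ : ∀ K a T → K * a + 4 * (4 * K) * T ≡ K * (a + 16 * T)
    ring₃ = solve-∀

-- Quotients of fractions close to 1.

toℚᵘ-/ : ∀ a b .{{_ : NonZero b}} → ℚ.toℚᵘ (+ a / b) ℚᵘ.≃ + a ℚᵘ./ b
toℚᵘ-/ a (suc b) = ℚ.toℚᵘ-fromℚᵘ (+ a ℚᵘ./ suc b)

-- Checked among unnormalised rationals, where equality is integer cross-multiplication and no
-- reduction to lowest terms interferes.
/-cancelʳ-* : ∀ a b p q .{{_ : NonZero b}} .{{_ : NonZero q}} .{{_ : NonZero (p * b)}} →
  (+ (a * q) / (p * b)) ℚ.* (+ p / q) ≡ + a / b
/-cancelʳ-* a b@(suc _) p@(suc _) q@(suc _) = ℚ.toℚᵘ-injective (begin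
  ℚ.toℚᵘ ((+ (a * q) / (p * b)) ℚ.* (+ p / q))
    ≈⟨ ℚ.toℚᵘ-homo-* (+ (a * q) / (p * b)) (+ p / q) ⟩
  ℚ.toℚᵘ (+ (a * q) / (p * b)) ℚᵘ.* ℚ.toℚᵘ (+ p / q)
    ≈⟨ ℚᵘ.*-cong (toℚᵘ-/ (a * q) (p * b)) (toℚᵘ-/ p q) ⟩
  (+ (a * q) ℚᵘ./ (p * b)) ℚᵘ.* (+ p ℚᵘ./ q)
    ≈⟨ ℚᵘ.*≡* cross ⟩
  + a ℚᵘ./ b
    ≈⟨ toℚᵘ-/ a b ⟨
  ℚ.toℚᵘ (+ a / b)
    ∎)
  where
  open import Relation.Binary.Reasoning.Setoid ℚᵘ.≃-setoid
  ring : ∀ a b p q → (a * q) * p * b ≡ a * (p * b * q)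
  ring = solve-∀
  cross : + (a * q) ℤ.* + p ℤ.* + b ≡ + a ℤ.* + (p * b * q)
  cross = trans (cong (ℤ._* + b) (sym (ℤ.pos-* (a * q) p)))
         (trans (sym (ℤ.pos-* (a * q * p) b))
         (trans (cong +_ (ring a b p q)) (ℤ.pos-* a (p * b * q))))

/-÷-/ : ∀ a b p q .{{_ : NonZero b}} .{{_ : NonZero q}} .{{_ : NonZero (p * b)}} .{{_ : ℚ.NonZero (+ p / q)}} →
  (+ a / b) ℚ.÷ (+ p / q) ≡ + (a * q) / (p * b)
/-÷-/ a b p q = begin
  (+ a / b) ℚ.* ℚ.1/ (+ p / q)           ≡⟨ cong (ℚ._* ℚ.1/ (+ p / q)) (/-cancelʳ-* a b p q) ⟨
  k ℚ.* (+ p / q) ℚ.* ℚ.1/ (+ p / q)     ≡⟨ ℚ.*-assoc k (+ p / q) (ℚ.1/ (+ p / q)) ⟩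
  k ℚ.* ((+ p / q) ℚ.* ℚ.1/ (+ p / q))   ≡⟨ cong (k ℚ.*_) (ℚ.*-inverseʳ (+ p / q)) ⟩
  k ℚ.* ℚ.1ℚ                             ≡⟨ ℚ.*-identityʳ k ⟩
  k                                      ∎
  where
  open ≡-Reasoning
  k = + (a * q) / (p * b)

∣k-1∣<ε : ∀ {k ε} → k ℚ.≤ ℚ.1ℚ → ℚ.1ℚ ℚ.< ε ℚ.+ k → ℚ.∣ k ℚ.- ℚ.1ℚ ∣ ℚ.< ε
∣k-1∣<ε {k} {ε} k≤1 1<ε+k = begin-strict
  ℚ.∣ k ℚ.- ℚ.1ℚ ∣          ≡⟨ ℚ.∣-p∣≡∣p∣ (k ℚ.- ℚ.1ℚ) ⟨
  ℚ.∣ ℚ.- (k ℚ.- ℚ.1ℚ) ∣    ≡⟨ cong ℚ.∣_∣ (trans (ℚ.neg-distrib-+ k (ℚ.- ℚ.1ℚ)) (ℚ.+-comm (ℚ.- k) ℚ.1ℚ)) ⟩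
  ℚ.∣ ℚ.1ℚ ℚ.- k ∣          ≡⟨ ℚ.0≤p⇒∣p∣≡p (subst (ℚ._≤ ℚ.1ℚ ℚ.- k) (ℚ.+-inverseʳ k) (ℚ.+-monoˡ-≤ (ℚ.- k) k≤1)) ⟩
  ℚ.1ℚ ℚ.- k                <⟨ ℚ.+-monoˡ-< (ℚ.- k) 1<ε+k ⟩
  ε ℚ.+ k ℚ.- k             ≡⟨ ℚ.+-assoc ε k (ℚ.- k) ⟩
  ε ℚ.+ (k ℚ.- k)           ≡⟨ cong (ε ℚ.+_) (ℚ.+-inverseʳ k) ⟩
  ε ℚ.+ ℚ.0ℚ                ≡⟨ ℚ.+-identityʳ ε ⟩
  ε                         ∎
  where open ℚ.≤-Reasoning

/≤1 : ∀ {u v} .{{_ : NonZero v}} → u ≤ v → + u / v ℚ.≤ ℚ.1ℚ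
/≤1 {u} {v@(suc _)} u≤v = ℚ.toℚᵘ-cancel-≤ (ℚᵘ.≤-respˡ-≃ (ℚᵘ.≃-sym (toℚᵘ-/ u v))
  (ℚᵘ.*≤* (subst₂ ℤ._≤_ (sym (ℤ.*-identityʳ (+ u))) (sym (ℤ.*-identityˡ (+ v))) (ℤ.+≤+ u≤v))))

-- A positive `ε` has numerator at least 1, so it is at least the reciprocal of its denominator D;
-- the hypothesis is 1 < 1/D + u/v with denominators cleared.
1<ε+/ : ∀ {ε u v} .{{_ : NonZero v}} → ℚ.0ℚ ℚ.< ε → ℚ.↧ₙ ε * v < v + u * ℚ.↧ₙ ε → ℚ.1ℚ ℚ.< ε ℚ.+ + u / v
1<ε+/ {ℚ.mkℚ (+ zero)   _ _} 0<ε _ = contradiction (ℚ.positive 0<ε) λ ()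
1<ε+/ {ℚ.mkℚ (-[1+ _ ]) _ _} 0<ε _ = contradiction (ℚ.positive 0<ε) λ ()
1<ε+/ {ε@(ℚ.mkℚ (+ suc e) d-1 _)} {u} {v@(suc _)} _ Dv<v+uD = ℚ.toℚᵘ-cancel-<
  (ℚᵘ.<-respʳ-≃ (ℚᵘ.≃-sym ε+u/v≃) (ℚᵘ.*<* (subst₂ ℤ._<_ lhs rhs (ℤ.+<+ num<))))
  where
  D = suc d-1
  ε+u/v≃ : ℚ.toℚᵘ (ε ℚ.+ + u / v) ℚᵘ.≃ ℚ.toℚᵘ ε ℚᵘ.+ + u ℚᵘ./ v
  ε+u/v≃ = ℚᵘ.≃-trans (ℚ.toℚᵘ-homo-+ ε (+ u / v)) (ℚᵘ.+-congʳ (ℚ.toℚᵘ ε) (toℚᵘ-/ u v))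
  num< : D * v < suc e * v + u * D
  num< = ℕ.<-≤-trans Dv<v+uD (ℕ.+-monoˡ-≤ (u * D) (ℕ.m≤m+n v (e * v)))
  lhs : + (D * v) ≡ + 1 ℤ.* + (D * v)
  lhs = sym (ℤ.*-identityˡ (+ (D * v)))
  rhs : + (suc e * v + u * D) ≡ (+ suc e ℤ.* + v ℤ.+ + u ℤ.* + D) ℤ.* + 1
  rhs = trans (ℤ.pos-+ (suc e * v) (u * D))
       (trans (cong₂ ℤ._+_ (ℤ.pos-* (suc e) v) (ℤ.pos-* u D))
              (sym (ℤ.*-identityʳ (+ suc e ℤ.* + v ℤ.+ + u ℤ.* + D))))

-- With δ = v - u the last hypothesis reads n δ ≤ 16 v. Since n is at least 17 D, this gives 17 D δ
-- ≤ 16 v < 17 v, hence D δ < v; taking 17 rather than 16 makes the inequality strict.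
ratio-bound : ∀ {D n u v} .{{_ : NonZero v}} → 17 * D ≤ n → u ≤ v → n * v ≤ n * u + 16 * v → D * v < v + u * D
ratio-bound {D} {n} {u} {v} 17D≤n u≤v nv≤ with ℕ.m≤n⇒∃[o]m+o≡n u≤v
... | δ , refl = begin-strict
  D * v             ≡⟨ ring₁ D u δ ⟩
  D * δ + u * D     <⟨ ℕ.+-monoˡ-< (u * D) Dδ<v ⟩
  v + u * D         ∎
  where
  open ℕ.≤-Reasoning
  ring₁ : ∀ D u δ → D * (u + δ) ≡ D * δ + u * D
  ring₁ = solve-∀
  nδ≤16v : n * δ ≤ 16 * v
  nδ≤16v = ℕ.+-cancelˡ-≤ (n * u) _ _ (subst (_≤ n * u + 16 * v) (ℕ.*-distribˡ-+ n u δ) nv≤)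
  Dδ<v : D * δ < v
  Dδ<v = ℕ.*-cancelˡ-< 17 _ _ (begin-strict
    17 * (D * δ)    ≡⟨ ℕ.*-assoc 17 D δ ⟨
    17 * D * δ      ≤⟨ ℕ.*-monoˡ-≤ δ 17D≤n ⟩
    n * δ           ≤⟨ nδ≤16v ⟩
    16 * v          <⟨ ℕ.m<n+m (16 * v) (>-nonZero⁻¹ v) ⟩
    17 * v          ∎)

-- The equation `T * q ≡ p * b` says that p/q equals T/b, so the quotient is a/T, which lies between
-- 1 - 16/n and 1.
÷-close-to-1 : ∀ {ε n a b p q T} .{{_ : NonZero b}} .{{_ : NonZero q}} .{{_ : NonZero p}} →
  ℚ.0ℚ ℚ.< ε → 17 * ℚ.↧ₙ ε ≤ n → T * q ≡ p * b → a ≤ T → n * T ≤ n * a + 16 * T →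
  ∃ λ (p/q≢0 : ℚ.NonZero (+ p / q)) → ℚ.∣ ((+ a / b) ℚ.÷ (+ p / q)) {{p/q≢0}} ℚ.- ℚ.1ℚ ∣ ℚ.< ε
÷-close-to-1 {ε} {n} {a} {b} {p} {q} {T} 0<ε 17D≤n Tq≡pb a≤T nT≤ =
  p/q≢0 , subst (λ r → ℚ.∣ r ℚ.- ℚ.1ℚ ∣ ℚ.< ε) (sym (/-÷-/ a b p q))
            (∣k-1∣<ε (/≤1 u≤v) (1<ε+/ {ε} {a * q} {p * b} 0<ε (ratio-bound {ℚ.↧ₙ ε} 17D≤n u≤v nv≤)))
  where
  instance
    p/q≢0 : ℚ.NonZero (+ p / q)
    p/q≢0 = ℚ.pos⇒nonZero (+ p / q) {{ℚ.normalize-pos p q}}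
    pb≢0 : NonZero (p * b)
    pb≢0 = ℕ.m*n≢0 p b
  u≤v : a * q ≤ p * b
  u≤v = subst (a * q ≤_) Tq≡pb (ℕ.*-monoˡ-≤ q a≤T)
  nv≤ : n * (p * b) ≤ n * (a * q) + 16 * (p * b)
  nv≤ = subst (λ v → n * v ≤ n * (a * q) + 16 * v) Tq≡pb (begin
    n * (T * q)                  ≡⟨ ℕ.*-assoc n T q ⟨
    n * T * q                    ≤⟨ ℕ.*-monoˡ-≤ q nT≤ ⟩
    (n * a + 16 * T) * q         ≡⟨ ring n a T q ⟩
    n * (a * q) + 16 * (T * q)   ∎)
    where
    open ℕ.≤-Reasoning
    ring : ∀ n a T q → (n * a + 16 * T) * q ≡ n * (a * q) + 16 * (T * q)
    ring = solve-∀

-- The main term and the limit.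

total-of-lines : ∀ n →
  4 * suc n * extensions (filling (ℓ₀ {n})) * (suc n ^ 2) ! ≡
  4 * suc n ^ (suc n + 1) * (suc n ^ 2 ∸ suc n) ! * length (Ω (suc n))
total-of-lines n-1 = begin
  4 * N * S * (N ^ 2) !                         ≡⟨ cong (λ k → 4 * N * S * k !) N^2≡N*N ⟩
  4 * N * S * (N * N) !                         ≡⟨ ℕ.*-assoc (4 * N) S _ ⟩
  4 * N * (S * (N * N) !)                       ≡⟨ cong (4 * N *_) (extensions-line (ℓ₀ {n-1})) ⟩
  4 * N * (N ^ N * (N * N ∸ N) ! * length (Ω N))
    ≡⟨ ring N (N ^ N) ((N * N ∸ N) !) (length (Ω N)) ⟩
  4 * (N * N ^ N) * (N * N ∸ N) ! * length (Ω N)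
    ≡⟨ cong₂ (λ e k → 4 * N ^ e * (k ∸ N) ! * length (Ω N)) (ℕ.+-comm 1 N) (sym N^2≡N*N) ⟩
  4 * N ^ (N + 1) * (N ^ 2 ∸ N) ! * length (Ω N) ∎
  where
  open ≡-Reasoning
  N S : ℕ
  N = suc n-1
  S = extensions (filling (ℓ₀ {n-1}))
  N^2≡N*N : N ^ 2 ≡ N * N
  N^2≡N*N = cong₂ _*_ {N} refl (ℕ.*-identityʳ N)
  ring : ∀ n k f l → 4 * n * (k * f * l) ≡ 4 * (n * k) * f * l
  ring = solve-∀

corollary1p1p1 : (λ n → uniformProb (Ω n) {{length-Ω≢0 n}} isConsecutive?)
    ∼ (λ n → (+ (4 * n ^ (n + 1) * (n ^ 2 ∸ n) !) / (n ^ 2) !) {{(n ^ 2) !≢0}})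
-- The summand 3 allows writing n as `3 + m`, as the bounds on consecutive squares require; the
-- other summand meets the threshold of `ratio-bound`.
corollary1p1p1 ε 0<ε = 3 + 17 * ℚ.↧ₙ ε , λ n N≤n → eventually n N≤n (ℕ.m≤n⇒∃[o]m+o≡n (ℕ.m+n≤o⇒m≤o 3 N≤n))
  where
  eventually : ∀ n → 3 + 17 * ℚ.↧ₙ ε ≤ n → (∃ λ m → 3 + m ≡ n) →
    let P = uniformProb (Ω n) {{length-Ω≢0 n}} isConsecutive?
        Q = (+ (4 * n ^ (n + 1) * (n ^ 2 ∸ n) !) / (n ^ 2) !) {{(n ^ 2) !≢0}}
    in ∃ λ (Q≢0 : ℚ.NonZero Q) → ℚ.∣ (P ℚ.÷ Q) {{Q≢0}} ℚ.- ℚ.1ℚ ∣ ℚ.< ε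
  -- Here a/b is the probability, p/q the asserted main term and `T` the union bound `4 * n * S`;
  -- `total-of-lines` supplies `T * q ≡ p * b`.
  eventually n N≤n (m , refl) = ÷-close-to-1
    {{length-Ω≢0 n}} {{(n ^ 2) !≢0}}
    {{ℕ.m*n≢0 (4 * n ^ (n + 1)) _ {{ℕ.m*n≢0 4 _ {{_}} {{ℕ.m^n≢0 n (n + 1)}}}} {{(n ^ 2 ∸ n) !≢0}}}}
    0<ε (ℕ.m+n≤o⇒n≤o 3 N≤n) (total-of-lines (2 + m)) (consecutive-≤ m) (consecutive-≥ m)
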